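{- For every BPPS instance, every feasible solution $(x,y,z)$ of the integer linear program $\mathrm{ILP}_{\mathrm N}$ satisfies the Minimum Classes Inequalities $$\sum_{b\in\mathcal B}y_{cb}\ \ge\ \left\lceil\frac{\sum_{i\in\mathcal I_c}w_i}{d-s_c}\right\rceil\qquad\text{for all }c\in\mathcal C.$$
   Context: Bin Packing Problem with Setups (BPPS). An instance consists of: a bin capacity $d\in\mathbb Z_{\ge1}$; items $\mathcal I=\{1,\dots,n\}$ with weights $w_i\in\mathbb Z_{\ge1}$; classes $\mathcal C=\{1,\dots,m\}$ and a partition $\{\mathcal I_1,\dots,\mathcal I_m\}$ of $\mathcal I$ into (nonempty) classes; for each class $c$ a setup weight $s_c\in\mathbb Z_{\ge0}$ and a setup cost $f_c\in\mathbb Z_{\ge0}$; a bin cost $r\in\mathbb Z_{\ge1}$. It is assumed that $w_i+s_c\le d$ for all $c\in\mathcal C$, $i\in\mathcal I_c$, and that the items cannot all be packed in a single bin, i.e. $\sum_{i\in\mathcal I}w_i+\sum_{c\in\mathcal C}s_c>d$. For $S\subseteq\mathcal I$ let $\mathcal C(S)=\{c\in\mathcal C: S\cap\mathcal I_c\neq\emptyset\}$. A packing pattern is a subset $S\subseteq\mathcal I$ with $\sum_{i\in S}w_i+\sum_{c\in\mathcal C(S)}s_c\le d$. A feasible BPPS solution is a partition $\mathcal S$ of $\mathcal I$ into (nonempty) packing patterns (used bins); its cost is $r|\mathcal S|+\sum_{S\in\mathcal S}\sum_{c\in\mathcal C(S)}f_c$, to be minimized. Let $k\in\mathbb Z_{\ge1}$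 be an upper bound on the number of bins used in any optimal BPPS solution and $\mathcal B=\{1,\dots,k\}$. The integer linear program $\mathrm{ILP}_{\mathrm N}$ is: minimize $\sum_{b\in\mathcal B}\big(r z_b+\sum_{c\in\mathcal C}f_c y_{cb}\big)$ subject to - $\sum_{b\in\mathcal B}x_{ib}=1$ for all $i\in\mathcal I$; - $\sum_{i\in\mathcal I}w_ix_{ib}+\sum_{c\in\mathcal C}s_cy_{cb}\le d\,z_b$ for all $b\in\mathcal B$; - $x_{ib}\le y_{cb}$ for all $c\in\mathcal C$, $i\in\mathcal I_c$, $b\in\mathcal B$; - $x_{ib},y_{cb},z_b\in\{0,1\}$ for all $i\in\mathcal I,c\in\mathcal C,b\in\mathcal B$. -}

module Defs where

open import Data.Bool using (if_then_else_)
open import Data.Fin using (Fin)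
open import Data.Fin.Subset using (Subset; _∈_; _∩_; Nonempty)
open import Data.Fin.Subset.Properties using (nonempty?)
open import Data.Nat
  using (ℕ; _+_; _*_; _∸_; _≤_; _<_; _>_; _≥_; NonZero; >-nonZero)
open import Data.Nat.Properties
  using (+-0-commutativeMonoid; +-monoˡ-≤; ≤-trans; m<n⇒0<n∸m)
open import Data.Product using (∃; _,_)
open import Data.Sum using (_⊎_)
open import Data.Vec using (lookup; tabulate)
open import Relation.Binary.PropositionalEquality using (_≡_)
open import Relation.Nullary using (does)

open import Algebra.Properties.CommutativeMonoid.Sum +-0-commutativeMonoid public
  using (sum-syntax)

sumOver : ∀ {n} → Subset n → (Fin n → ℕ) → ℕ
sumOver {n} S g = ∑[ i < n ] (if lookup S i then g i else 0)

-- A partition of {1,…,n} into p blocks is listed as a family of blocks;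
-- the order of the listing is immaterial to everything below.
record IsPartition {n p : ℕ} (P : Fin p → Subset n) : Set where
  field
    nonempty : ∀ a → Nonempty (P a)
    disjoint : ∀ {a b i} → i ∈ P a → i ∈ P b → a ≡ b
    covering : ∀ i → ∃ λ a → i ∈ P a

record Instance : Set where
  field
    d : ℕ                       -- bin capacity
    n : ℕ                       -- number of items
    m : ℕ                       -- number of classes
    w : Fin n → ℕ               -- item weights
    items : Fin m → Subset n    -- the classes 𝓘_c
    s : Fin m → ℕ               -- setup weights
    f : Fin m → ℕ               -- setup costs
    r : ℕ                       -- bin cost
    d≥1 : d ≥ 1
    w≥1 : ∀ i → w i ≥ 1
    r≥1 : r ≥ 1
    items-partition : IsPartition items
    w+s≤d : ∀ c {i} → i ∈ items c → w i + s c ≤ d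
    not-one-bin : (∑[ i < n ] w i) + (∑[ c < m ] s c) > d

  s<d : ∀ c → s c < d
  s<d c with IsPartition.nonempty items-partition c
  ... | i , i∈c = ≤-trans (+-monoˡ-≤ (s c) (w≥1 i)) (w+s≤d c i∈c)

  -- Also shows that the truncated difference d ∸ s c is the true d − s_c.
  d∸s-nonZero : ∀ c → NonZero (d ∸ s c)
  d∸s-nonZero c = >-nonZero (m<n⇒0<n∸m (s<d c))

module _ (I : Instance) where
  open Instance I

  -- 𝓒(S)
  classesOf : Subset n → Subset m
  classesOf S = tabulate λ c → does (nonempty? (S ∩ items c))

  IsPattern : Subset n → Set
  IsPattern S = sumOver S w + sumOver (classesOf S) s ≤ d

  record Solution : Set where
    field
      bins      : ℕ
      packs  : Fin bins → Subset n
      partition : IsPartition packs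
      packing   : ∀ b → IsPattern (packs b)

  cost : Solution → ℕ
  cost σ = r * bins + (∑[ b < bins ] sumOver (classesOf (packs b)) f)
    where open Solution σ

  IsOptimal : Solution → Set
  IsOptimal σ = ∀ τ → cost σ ≤ cost τ

  BoundsOptimalBins : ℕ → Set
  BoundsOptimalBins k = ∀ σ → IsOptimal σ → Solution.bins σ ≤ k

  IsBinary : ℕ → Set
  IsBinary v = v ≡ 0 ⊎ v ≡ 1

  record ILPFeasible (k : ℕ) (x : Fin n → Fin k → ℕ)
                     (y : Fin m → Fin k → ℕ) (z : Fin k → ℕ) : Set where
    field
      assignment : ∀ i → ∑[ b < k ] x i b ≡ 1
      capacity   : ∀ b → (∑[ i < n ] (w i * x i b)) + (∑[ c < m ] (s c * y c b))
                         ≤ d * z b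
      setup      : ∀ c {i} → i ∈ items c → ∀ b → x i b ≤ y c b
      x-binary   : ∀ i b → IsBinary (x i b)
      y-binary   : ∀ c b → IsBinary (y c b)
      z-binary   : ∀ b → IsBinary (z b)

{-# OPTIONS --safe #-}
-- A bin b with y_cb = 1 carries at most d − s_c of class c, by its capacity
-- constraint; one with y_cb = 0 carries none, by the setup constraints.
-- Summing over the bins, the weight of class c is at most (d − s_c) Σ_b y_cb,
-- and Σ_b y_cb is an integer.
module Submission where

open import Defs
open import Data.Bool using (true; false; if_then_else_)
open import Data.Fin using (Fin; zero; suc)
open import Data.Integer using (+_) renaming (_≥_ to _≥ℤ_)
import Data.Integer as ℤ
import Data.Integer.DivMod as ℤ
import Data.Integer.GCD as ℤ
import Data.Integer.Properties as ℤ
open import Data.Nat using (ℕ; zero; suc; _≥_; _∸_; _+_; _*_; _≤_; NonZero; z≤n)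
open import Data.Nat.GCD using (gcd[m,n]≢0)
open import Data.Nat.Properties
open import Data.Rational using (mkℚ; ↥_; ↧_; _/_; floor; ceiling) renaming (-_ to -ℚ_)
open import Data.Rational.Properties using (↥-neg; ↧-neg; ↥-/; ↧-/)
open import Data.Sum using (inj₁; inj₂)
open import Data.Vec using (lookup)
open import Data.Vec.Properties using (lookup⇒[]=)
open import Relation.Binary.PropositionalEquality using (sym; trans; cong)
open import Algebra.Properties.Semiring.Sum +-*-semiring
  using (sum-cong-≗; ∑-comm; *-distribˡ-sum; *-distribʳ-sum)

-- Division with remainder puts the numerator strictly below `suc (floor p)` times the denominator.
-- Cancelling the positive denominator leaves `i` strictly below `suc (floor p)`, which for integers
-- is the claim.
i*↧p≤↥p⇒i≤floor[p] : ∀ i p → i ℤ.* ↧ p ℤ.≤ ↥ p → i ℤ.≤ floor p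
i*↧p≤↥p⇒i≤floor[p] i p@(mkℚ n d-1 _) i*↧p≤↥p =
  ℤ.≤-trans i≤n/d (ℤ.≤-reflexive (sym (ℤ.div-pos-is-/ℕ n (suc d-1))))
  where
  i≤n/d : i ℤ.≤ n ℤ./ℕ suc d-1
  i≤n/d = ℤ.≤-trans
    (ℤ.i<j⇒i≤pred[j] {j = ℤ.suc (n ℤ./ℕ suc d-1)} (ℤ.*-cancelʳ-<-nonNeg (+ suc d-1)
      (ℤ.≤-<-trans i*↧p≤↥p (ℤ.n<s[n/ℕd]*d n (suc d-1)))))
    (ℤ.≤-reflexive (ℤ.pred-suc _))

-- The ceiling is the negated floor of `-ℚ p`, so this is the floor bound for the negations of `i`
-- and `p`.
↥p≤i*↧p⇒ceiling[p]≤i : ∀ p i → ↥ p ℤ.≤ i ℤ.* ↧ p → ceiling p ℤ.≤ i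
↥p≤i*↧p⇒ceiling[p]≤i p@(mkℚ _ _ _) i ↥p≤i*↧p = begin
  ℤ.- floor (-ℚ p)  ≤⟨ ℤ.neg-mono-≤ (i*↧p≤↥p⇒i≤floor[p] (ℤ.- i) (-ℚ p) -i*↧≤↥) ⟩
  ℤ.- ℤ.- i         ≡⟨ ℤ.neg-involutive i ⟩
  i                 ∎
  where
  open ℤ.≤-Reasoning
  -i*↧≤↥ : ℤ.- i ℤ.* ↧ (-ℚ p) ℤ.≤ ↥ (-ℚ p)
  -i*↧≤↥ = begin
    ℤ.- i ℤ.* ↧ (-ℚ p)  ≡⟨ cong (ℤ.- i ℤ.*_) (↧-neg p) ⟩
    ℤ.- i ℤ.* ↧ p       ≡⟨ ℤ.neg-distribˡ-* i (↧ p) ⟨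
    ℤ.- (i ℤ.* ↧ p)     ≤⟨ ℤ.neg-mono-≤ ↥p≤i*↧p ⟩
    ℤ.- ↥ p             ≡⟨ ↥-neg p ⟨
    ↥ (-ℚ p)            ∎

-- The fraction `i / n` is stored in lowest terms. Multiplying its numerator and denominator by the
-- gcd `g` restores `i` and `n`; since `g` is positive it can be cancelled afterwards.
i≤j*n⇒ceiling[i/n]≤j : ∀ i n j .{{_ : NonZero n}} → i ℤ.≤ j ℤ.* + n → ceiling (i / n) ℤ.≤ j
i≤j*n⇒ceiling[i/n]≤j i n@(suc _) j i≤j*n =
  ↥p≤i*↧p⇒ceiling[p]≤i p j (ℤ.*-cancelʳ-≤-pos (↥ p) (j ℤ.* ↧ p) g (begin
    ↥ p ℤ.* g          ≡⟨ ↥-/ i n ⟩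
    i                  ≤⟨ i≤j*n ⟩
    j ℤ.* + n          ≡⟨ cong (j ℤ.*_) (↧-/ i n) ⟨
    j ℤ.* (↧ p ℤ.* g)  ≡⟨ ℤ.*-assoc j (↧ p) g ⟨
    j ℤ.* ↧ p ℤ.* g    ∎))
  where
  open ℤ.≤-Reasoning
  p = i / n
  g = ℤ.gcd i (+ n)
  instance
    g-positive : ℤ.Positive g
    g-positive = ℤ.positive (ℤ.+<+ (n≢0⇒n>0 (gcd[m,n]≢0 ℤ.∣ i ∣ n (inj₂ λ ()))))

sum-mono-≤ : ∀ {n} {g h : Fin n → ℕ} → (∀ i → g i ≤ h i) → ∑[ i < n ] g i ≤ ∑[ i < n ] h i
sum-mono-≤ {zero}  g≤h = z≤n
sum-mono-≤ {suc n} g≤h = +-mono-≤ (g≤h zero) (sum-mono-≤ (λ i → g≤h (suc i)))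

term≤sum : ∀ {n} (g : Fin n → ℕ) i → g i ≤ ∑[ j < n ] g j
term≤sum g zero    = m≤m+n (g zero) _
term≤sum g (suc i) = ≤-trans (term≤sum (λ j → g (suc j)) i) (m≤n+m _ (g zero))

module _ (I : Instance) {k : ℕ}
         {x : Fin (Instance.n I) → Fin k → ℕ} {y : Fin (Instance.m I) → Fin k → ℕ}
         {z : Fin k → ℕ} (feasible : ILPFeasible I k x y z) (c : Fin (Instance.m I)) where
  open Instance I
  open ILPFeasible feasible
  open ≤-Reasoning

  -- Weights are set to zero outside the class, so that sums range over all items as in the program;
  -- the total is `sumOver (items c) w` by definition.
  classWeight : Fin n → ℕ
  classWeight i = if lookup (items c) i then w i else 0

  classWeight≤w : ∀ i → classWeight i ≤ w i
  classWeight≤w i with lookup (items c) i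
  ... | true  = ≤-refl
  ... | false = z≤n

  classWeight*x≤classWeight*y : ∀ b i → classWeight i * x i b ≤ classWeight i * y c b
  classWeight*x≤classWeight*y b i with lookup (items c) i in eq
  ... | true  = *-monoʳ-≤ (w i) (setup c (lookup⇒[]= i (items c) eq) b)
  ... | false = z≤n

  z≤1 : ∀ b → z b ≤ 1
  z≤1 b with z-binary b
  ... | inj₁ z≡0 = ≤-trans (≤-reflexive z≡0) z≤n
  ... | inj₂ z≡1 = ≤-reflexive z≡1

  binClassWeight≤[d∸s]*y : ∀ b → ∑[ i < n ] (classWeight i * x i b) ≤ (d ∸ s c) * y c b
  binClassWeight≤[d∸s]*y b with y-binary c b
  ... | inj₁ y≡0 = begin
    ∑[ i < n ] (classWeight i * x i b)  ≤⟨ sum-mono-≤ (classWeight*x≤classWeight*y b) ⟩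
    ∑[ i < n ] (classWeight i * y c b)  ≡⟨ *-distribʳ-sum (y c b) classWeight ⟨
    (∑[ i < n ] classWeight i) * y c b  ≡⟨ cong (sumOver (items c) w *_) y≡0 ⟩
    (∑[ i < n ] classWeight i) * 0      ≡⟨ *-zeroʳ (sumOver (items c) w) ⟩
    0                                   ≤⟨ z≤n ⟩
    (d ∸ s c) * y c b                   ∎
  ... | inj₂ y≡1 = begin
    -- The setup of `c` occupies `s c` of the bin, so only the rest is left for its items.
    ∑[ i < n ] (classWeight i * x i b)  ≤⟨ m+n≤o⇒m≤o∸n _ load≤d ⟩
    d ∸ s c                             ≡⟨ *-identityʳ (d ∸ s c) ⟨
    (d ∸ s c) * 1                       ≡⟨ cong ((d ∸ s c) *_) y≡1 ⟨
    (d ∸ s c) * y c b                   ∎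
    where
    s≤setups : s c ≤ ∑[ c′ < m ] (s c′ * y c′ b)
    s≤setups = begin
      s c                           ≡⟨ *-identityʳ (s c) ⟨
      s c * 1                       ≡⟨ cong (s c *_) y≡1 ⟨
      s c * y c b                   ≤⟨ term≤sum (λ c′ → s c′ * y c′ b) c ⟩
      ∑[ c′ < m ] (s c′ * y c′ b)   ∎

    load≤d : (∑[ i < n ] (classWeight i * x i b)) + s c ≤ d
    load≤d = begin
      (∑[ i < n ] (classWeight i * x i b)) + s c
        -- Adding the items and setups of the other classes only increases the load, and yields the
        -- left side of the capacity constraint.
        ≤⟨ +-mono-≤ (sum-mono-≤ λ i → *-monoˡ-≤ (x i b) (classWeight≤w i)) s≤setups ⟩
      (∑[ i < n ] (w i * x i b)) + (∑[ c′ < m ] (s c′ * y c′ b))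
        ≤⟨ capacity b ⟩
      d * z b
        ≤⟨ *-monoʳ-≤ d (z≤1 b) ⟩
      d * 1
        ≡⟨ *-identityʳ d ⟩
      d ∎

  -- Double counting: the assignment constraints split each item's weight over the bins, and
  -- exchanging the two sums collects it bin by bin, where the bound for a single bin applies.
  totalClassWeight≤∑y*[d∸s] : sumOver (items c) w ≤ (∑[ b < k ] y c b) * (d ∸ s c)
  totalClassWeight≤∑y*[d∸s] = begin
    ∑[ i < n ] classWeight i
      ≡⟨ sum-cong-≗ (λ i → trans (cong (classWeight i *_) (assignment i)) (*-identityʳ _)) ⟨
    ∑[ i < n ] (classWeight i * (∑[ b < k ] x i b))
      ≡⟨ sum-cong-≗ (λ i → *-distribˡ-sum (classWeight i) (x i)) ⟩
    ∑[ i < n ] ∑[ b < k ] (classWeight i * x i b)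
      ≡⟨ ∑-comm (λ i b → classWeight i * x i b) ⟩
    ∑[ b < k ] ∑[ i < n ] (classWeight i * x i b)
      ≤⟨ sum-mono-≤ binClassWeight≤[d∸s]*y ⟩
    ∑[ b < k ] ((d ∸ s c) * y c b)
      ≡⟨ *-distribˡ-sum (d ∸ s c) (y c) ⟨
    (d ∸ s c) * (∑[ b < k ] y c b)
      ≡⟨ *-comm (d ∸ s c) _ ⟩
    (∑[ b < k ] y c b) * (d ∸ s c) ∎

proposition3 : (I : Instance) → let open Instance I in
    (k : ℕ) → k ≥ 1 → BoundsOptimalBins I k →
    (x : Fin n → Fin k → ℕ) (y : Fin m → Fin k → ℕ) (z : Fin k → ℕ) →
    ILPFeasible I k x y z →
    (c : Fin m) →
    + (∑[ b < k ] y c b) ≥ℤ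
    ceiling (_/_ (+ (sumOver (items c) w)) (d ∸ s c) {{d∸s-nonZero c}})
proposition3 I k _ _ x y z feasible c =
  i≤j*n⇒ceiling[i/n]≤j (+ sumOver (items c) w) (d ∸ s c) (+ ∑y) {{d∸s-nonZero c}}
    (ℤ.≤-trans (ℤ.+≤+ (totalClassWeight≤∑y*[d∸s] I feasible c))
               (ℤ.≤-reflexive (ℤ.pos-* ∑y (d ∸ s c))))
  where
  open Instance I
  ∑y = ∑[ b < k ] y c b
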